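{- Let $k\ge 1$ be an integer and let $F$ and $F'$ be graphs. Let $G=F\circ\overline{K_k}$ and $H=F'\circ\overline{K_k}$ be the $k$-coronas of $F$ and $F'$. Then $$\gamma_k^{\mathrm L}(G\square H)=\frac{n(G)\,n(H)}{k+1}.$$
   Context: All graphs are finite and simple; $n(G)=|V(G)|$, and $N_G(u)$ is the open neighborhood of $u$ in $G$. A set $D\subseteq V(G)$ is a dominating set if every vertex of $V(G)\setminus D$ has a neighbor in $D$. For an integer $k\ge 0$, a dominating set $D$ of $G$ is a $k$-limited dominating set if $|N_G(u)\setminus D|\le k$ for every $u\in D$. The $k$-limited domination number $\gamma_k^{\mathrm L}(G)$ is the minimum cardinality of a $k$-limited dominating set of $G$. The Cartesian product $G\square H$ has vertex set $V(G)\times V(H)$, with $(g,h)$ and $(g',h')$ adjacent if and only if either $g=g'$ and $hh'\in E(H)$, or $h=h'$ and $gg'\in E(G)$. The $k$-corona $F\circ\overline{K_k}$ of a graph $F$ is the graph obtained from $F$ by attaching $k$ new leaves to each vertex of $F$ (so it has $(k+1)\,n(F)$ vertices). -}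

module Defs where

open import Data.Empty using (⊥)
open import Data.Fin using (Fin)
import Data.Fin.Properties as Fin
open import Data.Fin.Subset using (Subset; ∣_∣; _─_; _∈_; _∉_; ⊤)
open import Data.Fin.Subset.Properties using (_∈?_; anySubset?; ∈⊤; p─⊤≡⊥; ∣⊥∣≡0)
open import Data.Nat using (ℕ; _+_; _*_; _≤_; _<_; _≤?_; _<?_; z≤n)
open import Data.Nat.Induction using (<-wellFounded)
open import Data.Nat.Properties using (≮⇒≥)
open import Data.Product using (_×_; _,_; ∃; ∃-syntax; proj₁; proj₂)
open import Data.Product.Function.NonDependent.Propositional using (_×-↔_)
open import Data.Sum using (_⊎_; inj₁; inj₂)
open import Data.Sum.Function.Propositional using (_⊎-↔_)
open import Data.Vec using (tabulate)
open import Function using (_∘_; _↔_; Inverse)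
open import Function.Properties.Inverse using (↔-refl; ↔-sym; ↔-trans; ↔⇒↣)
open import Induction.WellFounded using (Acc; acc)
open import Level using (0ℓ)
open import Relation.Binary using (Rel; DecidableEquality; Symmetric)
import Relation.Binary as B
open import Relation.Binary.PropositionalEquality using (_≡_; refl; sym; trans; cong; subst)
open import Relation.Nullary using (¬_; Dec; yes; no; does; contradiction)
open import Relation.Nullary.Decidable using (map′; via-injection; ¬?; _×-dec_; _⊎-dec_; _→-dec_)
open import Relation.Unary using (Pred; Decidable)

-- Adjacency carries a decision procedure so that neighbourhoods have a
-- cardinality; classically this is no restriction.
record Graph : Set₁ where
  infix 4 _~_ _~?_
  field
    V         : Set
    order     : ℕ
    enumerate : V ↔ Fin order
    _~_       : Rel V 0ℓ
    _~?_      : B.Decidable _~_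
    ~-sym     : Symmetric _~_
    ~-irrefl  : ∀ {v} → ¬ (v ~ v)

  index : V → Fin order
  index = Inverse.to enumerate

  vertex : Fin order → V
  vertex = Inverse.from enumerate

  _≟_ : DecidableEquality V
  _≟_ = via-injection (↔⇒↣ enumerate) Fin._≟_

  -- Vertex sets are subsets of the index set, so that cardinality and
  -- difference are those of Data.Fin.Subset.
  VertexSet : Set
  VertexSet = Subset order

  infix 4 _∈ᵛ_ _∉ᵛ_
  _∈ᵛ_ _∉ᵛ_ : V → VertexSet → Set
  v ∈ᵛ D = index v ∈ D
  v ∉ᵛ D = index v ∉ D

  N : V → VertexSet
  N u = tabulate (λ i → does (u ~? vertex i))

  allVertices? : {P : Pred V 0ℓ} → Decidable P → Dec (∀ v → P v)
  allVertices? {P} P? = map′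
    (λ h v → subst P (Inverse.strictlyInverseʳ enumerate v) (h (index v)))
    (λ h i → h (vertex i))
    (Fin.all? (P? ∘ vertex))

  anyVertex? : {P : Pred V 0ℓ} → Decidable P → Dec (∃ P)
  anyVertex? {P} P? = map′
    (λ (i , p) → vertex i , p)
    (λ (v , p) → index v , subst P (sym (Inverse.strictlyInverseʳ enumerate v)) p)
    (Fin.any? (P? ∘ vertex))

open Graph using (order)

module _ (G : Graph) where
  open Graph G hiding (order)

  IsDominating : VertexSet → Set
  IsDominating D = ∀ v → v ∉ᵛ D → ∃[ u ] (u ∈ᵛ D × v ~ u)

  IsLimitedDominating : ℕ → VertexSet → Set
  IsLimitedDominating k D =
    IsDominating D × (∀ u → u ∈ᵛ D → ∣ N u ─ D ∣ ≤ k)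

  isLimitedDominating? : ∀ k → Decidable (IsLimitedDominating k)
  isLimitedDominating? k D =
    allVertices? (λ v → ¬? (index v ∈? D) →-dec
      anyVertex? (λ u → (index u ∈? D) ×-dec (v ~? u)))
    ×-dec
    allVertices? (λ u → (index u ∈? D) →-dec (∣ N u ─ D ∣ ≤? k))

  allVerticesLimitedDominating : ∀ k → IsLimitedDominating k ⊤
  allVerticesLimitedDominating k =
    (λ v v∉⊤ → contradiction ∈⊤ v∉⊤) ,
    (λ u _ → subst (_≤ k)
      (sym (trans (cong ∣_∣ (p─⊤≡⊥ (N u))) (∣⊥∣≡0 (order G)))) z≤n)

IsMinimumCardinality : ∀ {n} → Pred (Subset n) 0ℓ → Subset n → Set
IsMinimumCardinality P D = P D × (∀ D′ → P D′ → ∣ D ∣ ≤ ∣ D′ ∣)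

minimumCardinality : ∀ {n} {P : Pred (Subset n) 0ℓ} → Decidable P →
                     ∃ P → ∃ (IsMinimumCardinality P)
minimumCardinality {P = P} P? (D₀ , p₀) = search D₀ p₀ (<-wellFounded ∣ D₀ ∣)
  where
  search : ∀ D → P D → Acc _<_ ∣ D ∣ → ∃ (IsMinimumCardinality P)
  search D p (acc rs) with anySubset? (λ D′ → P? D′ ×-dec (∣ D′ ∣ <? ∣ D ∣))
  ... | yes (D′ , p′ , D′<D) = search D′ p′ (rs D′<D)
  ... | no  none             = D , p , λ D′ p′ → ≮⇒≥ (λ D′<D → none (D′ , p′ , D′<D))

minimumLimitedDominatingSet : ∀ k G → ∃ (IsMinimumCardinality (IsLimitedDominating G k))
minimumLimitedDominatingSet k G =
  minimumCardinality (isLimitedDominating? G k) (⊤ , allVerticesLimitedDominating G k)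

γᴸ : ℕ → Graph → ℕ
γᴸ k G = ∣ proj₁ (minimumLimitedDominatingSet k G) ∣

infixr 7 _□_
_□_ : Graph → Graph → Graph
G □ H = record
  { V         = G.V × H.V
  ; order     = G.order * H.order
  ; enumerate = ↔-trans (G.enumerate ×-↔ H.enumerate) (↔-sym Fin.*↔×)
  ; _~_       = λ (g , h) (g′ , h′) → (g ≡ g′ × h H.~ h′) ⊎ (h ≡ h′ × g G.~ g′)
  ; _~?_      = λ (g , h) (g′ , h′) →
                  ((g G.≟ g′) ×-dec (h H.~? h′)) ⊎-dec ((h H.≟ h′) ×-dec (g G.~? g′))
  ; ~-sym     = λ { (inj₁ (e , a)) → inj₁ (sym e , H.~-sym a)
                  ; (inj₂ (e , a)) → inj₂ (sym e , G.~-sym a) }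
  ; ~-irrefl  = λ { (inj₁ (_ , a)) → H.~-irrefl a
                  ; (inj₂ (_ , a)) → G.~-irrefl a }
  }
  where
  module G = Graph G
  module H = Graph H

module _ (k : ℕ) (F : Graph) where
  private module F = Graph F

  -- inj₂ (v , i) is the i-th leaf attached to v.
  CoronaVertex : Set
  CoronaVertex = F.V ⊎ (F.V × Fin k)

  CoronaAdj : Rel CoronaVertex 0ℓ
  CoronaAdj (inj₁ u)       (inj₁ v)       = u F.~ v
  CoronaAdj (inj₁ u)       (inj₂ (v , _)) = u ≡ v
  CoronaAdj (inj₂ (u , _)) (inj₁ v)       = u ≡ v
  CoronaAdj (inj₂ _)       (inj₂ _)       = ⊥

  coronaAdj? : B.Decidable CoronaAdj
  coronaAdj? (inj₁ u)       (inj₁ v)       = u F.~? v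
  coronaAdj? (inj₁ u)       (inj₂ (v , _)) = u F.≟ v
  coronaAdj? (inj₂ (u , _)) (inj₁ v)       = u F.≟ v
  coronaAdj? (inj₂ _)       (inj₂ _)       = no λ ()

  coronaAdj-sym : Symmetric CoronaAdj
  coronaAdj-sym {inj₁ _} {inj₁ _} a = F.~-sym a
  coronaAdj-sym {inj₁ _} {inj₂ _} e = sym e
  coronaAdj-sym {inj₂ _} {inj₁ _} e = sym e

  coronaAdj-irrefl : ∀ {v} → ¬ CoronaAdj v v
  coronaAdj-irrefl {inj₁ _} a = F.~-irrefl a

  corona : Graph
  corona = record
    { V         = CoronaVertex
    ; order     = F.order + F.order * k
    ; enumerate = ↔-trans
        (F.enumerate ⊎-↔ ↔-trans (F.enumerate ×-↔ ↔-refl) (↔-sym Fin.*↔×))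
        (↔-sym Fin.+↔⊎)
    ; _~_       = CoronaAdj
    ; _~?_      = coronaAdj?
    ; ~-sym     = λ {u} {v} → coronaAdj-sym {u} {v}
    ; ~-irrefl  = λ {v} → coronaAdj-irrefl {v}
    }

{-# OPTIONS --safe #-}
-- V(G □ H) splits into n(F) n(F′) blocks, each a product of two stars, with
-- (k+1)² vertices indexed by rows and columns in Fin (k+1), index 0 being the
-- centre of a star.  The set V(G) × V(F′) is k-limited dominating and has k+1
-- vertices in each block.  Conversely every k-limited dominating set D has at
-- least k+1 vertices in each block.  If the whole centre row except possibly
-- (0, 0) lies in D, then since (0, 1) has k+1 neighbours in the block, one of
-- them lies in D as well.  Otherwise a vertex (0, j) is missing, and
-- domination of (i, j) puts a vertex of D in every row i ≠ 0; a further one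
-- lies in row 0 or else, by limitedness, in row 1.
module Submission where

open import Defs
open import Data.Empty using (⊥-elim)
open import Data.Fin using (Fin; zero; suc)
import Data.Fin.Properties as Fin
open import Data.Fin.Subset using (Subset; ∣_∣; _─_; _-_; _∈_; _∉_; inside; outside)
open import Data.Fin.Subset.Properties
  using (_∈?_; Empty-unique; ∣⊥∣≡0; p─⊥≡p; x∈p⇒∣p-x∣<∣p∣; x∈p∧x≢y⇒x∈p-y;
         x∈p∧x∉q⇒x∈p─q; p─q⊆p; x∈⁅x⁆)
open import Data.Integer using (+_)
import Data.Integer as ℤ
import Data.Integer.Properties as ℤ
open import Data.Nat using (ℕ; zero; suc; _≤_; _+_; _*_; z≤n; s≤s)
open import Data.Nat.Properties using (≤-antisym; ≤-trans; ≤-reflexive; 1+n≰n; m≤n⇒m≤1+n)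
open import Data.Nat.Solver using (module +-*-Solver)
open import Data.Product using (_×_; _,_; ∃; ∃-syntax; proj₁; proj₂)
open import Data.Product.Function.NonDependent.Propositional using (_×-↔_)
open import Data.Rational using (_/_)
open import Data.Rational.Properties using (fromℚᵘ-cong)
open import Data.Rational.Unnormalised using (mkℚᵘ; *≡*)
open import Data.Sum using (_⊎_; inj₁; inj₂; [_,_]′)
open import Data.Vec using (tabulate; _∷_; there)
open import Data.Vec.Properties using ([]=⇒lookup; lookup⇒[]=; lookup∘tabulate)
open import Function using (_∘_; _↔_; Inverse; Injective)
open import Function.Bundles using (Injection)
open import Function.Properties.Inverse using (↔-refl; ↔-sym; ↔-trans; ↔⇒↣)
open import Relation.Binary.PropositionalEquality
  using (_≡_; _≢_; refl; sym; trans; cong; cong₂; subst; module ≡-Reasoning)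
open import Relation.Nullary using (¬_; Dec; yes; no; does; contradiction)
open import Relation.Nullary.Decidable using (dec-true)
open import Relation.Unary using (Decidable)

-- Cardinality bounds for finite subsets.

x∈p─q⇒x∉q : ∀ {n} (p q : Subset n) {x} → x ∈ p ─ q → x ∉ q
x∈p─q⇒x∉q (_ ∷ p) (outside ∷ q) (there x∈) (there x∈q) = x∈p─q⇒x∉q p q x∈ x∈q
x∈p─q⇒x∉q (_ ∷ p) (inside  ∷ q) (there x∈) (there x∈q) = x∈p─q⇒x∉q p q x∈ x∈q

injective⇒≤∣p∣ : ∀ {m n} (p : Subset n) (f : Fin m → Fin n) →
                 Injective _≡_ _≡_ f → (∀ i → f i ∈ p) → m ≤ ∣ p ∣
injective⇒≤∣p∣ {zero}  p f inj f∈p = z≤n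
injective⇒≤∣p∣ {suc m} p f inj f∈p = ≤-trans
  (s≤s (injective⇒≤∣p∣ (p - f zero) (f ∘ suc) (Fin.suc-injective ∘ inj)
    (λ i → x∈p∧x≢y⇒x∈p-y (f∈p (suc i)) (λ e → contradiction (inj e) λ ()))))
  (x∈p⇒∣p-x∣<∣p∣ (f∈p zero))

∣p∣≤1+∣p-x∣ : ∀ {n} (p : Subset n) x → ∣ p ∣ ≤ suc ∣ p - x ∣
-- The singleton of `zero` has tail `⊥`, so below the head the removal leaves `p ─ ⊥`.
∣p∣≤1+∣p-x∣ (inside  ∷ p) zero    = s≤s (≤-reflexive (cong ∣_∣ (sym (p─⊥≡p p))))
∣p∣≤1+∣p-x∣ (outside ∷ p) zero    = m≤n⇒m≤1+n (≤-reflexive (cong ∣_∣ (sym (p─⊥≡p p))))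
∣p∣≤1+∣p-x∣ (inside  ∷ p) (suc x) = s≤s (∣p∣≤1+∣p-x∣ p x)
∣p∣≤1+∣p-x∣ (outside ∷ p) (suc x) = ∣p∣≤1+∣p-x∣ p x

covered⇒∣p∣≤ : ∀ {m n} (p : Subset n) (f : Fin m → Fin n) →
               (∀ {x} → x ∈ p → ∃[ i ] x ≡ f i) → ∣ p ∣ ≤ m
covered⇒∣p∣≤ {zero} {n} p f cover = ≤-reflexive (trans
  (cong ∣_∣ (Empty-unique {p = p} (λ (_ , x∈p) → contradiction (proj₁ (cover x∈p)) λ ())))
  (∣⊥∣≡0 n))
covered⇒∣p∣≤ {suc m} p f cover = ≤-trans (∣p∣≤1+∣p-x∣ p (f zero))
  (s≤s (covered⇒∣p∣≤ (p - f zero) (f ∘ suc) coverʳ))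
  where
  coverʳ : ∀ {x} → x ∈ p - f zero → ∃[ i ] x ≡ f (suc i)
  coverʳ x∈ with cover (p─q⊆p p _ x∈)
  ... | zero  , refl = contradiction (x∈⁅x⁆ _) (x∈p─q⇒x∉q p _ x∈)
  ... | suc i , e    = i , e

module _ {n} {P : Fin n → Set} (P? : Decidable P) where

  ∈-tabulate⁺ : ∀ {i} → P i → i ∈ tabulate (does ∘ P?)
  ∈-tabulate⁺ {i} Pi = lookup⇒[]= i _ (trans (lookup∘tabulate _ i) (dec-true (P? i) Pi))

  ∈-tabulate⁻ : ∀ {i} → i ∈ tabulate (does ∘ P?) → P i
  ∈-tabulate⁻ {i} i∈ with P? i | trans (sym (lookup∘tabulate (does ∘ P?) i)) ([]=⇒lookup i∈)
  ... | yes Pi | _ = Pi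

-- Counting in vertex sets of a graph.

module _ (G : Graph) where
  open Graph G

  vertex-index : ∀ v → vertex (index v) ≡ v
  vertex-index = Inverse.strictlyInverseʳ enumerate

  index-vertex : ∀ i → index (vertex i) ≡ i
  index-vertex = Inverse.strictlyInverseˡ enumerate

  index-injective : Injective _≡_ _≡_ index
  index-injective = Injection.injective (↔⇒↣ enumerate)

  setOf : {P : V → Set} → Decidable P → VertexSet
  setOf P? = tabulate (does ∘ P? ∘ vertex)

  ∈-setOf⁺ : ∀ {P : V → Set} (P? : Decidable P) {v} → P v → v ∈ᵛ setOf P?
  ∈-setOf⁺ {P} P? {v} = ∈-tabulate⁺ (P? ∘ vertex) ∘ subst P (sym (vertex-index v))

  ∈-setOf⁻ : ∀ {P : V → Set} (P? : Decidable P) {v} → v ∈ᵛ setOf P? → P v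
  ∈-setOf⁻ {P} P? {v} = subst P (vertex-index v) ∘ ∈-tabulate⁻ (P? ∘ vertex)

  module _ {A : Set} {m} (e : A ↔ Fin m) (D : VertexSet) (f : A → V) where

    injective⇒≤∣D∣ : Injective _≡_ _≡_ f → (∀ a → f a ∈ᵛ D) → m ≤ ∣ D ∣
    injective⇒≤∣D∣ inj f∈D = injective⇒≤∣p∣ D (index ∘ f ∘ Inverse.from e)
      (Injection.injective (↔⇒↣ (↔-sym e)) ∘ inj ∘ index-injective)
      (f∈D ∘ Inverse.from e)

    covered⇒∣D∣≤ : (∀ {v} → v ∈ᵛ D → ∃[ a ] v ≡ f a) → ∣ D ∣ ≤ m
    covered⇒∣D∣≤ cover = covered⇒∣p∣≤ D (index ∘ f ∘ Inverse.from e) coverᶠ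
      where
      coverᶠ : ∀ {x} → x ∈ D → ∃[ i ] x ≡ index (f (Inverse.from e i))
      coverᶠ {x} x∈D with cover (subst (_∈ D) (sym (index-vertex x)) x∈D)
      ... | a , vx≡fa = Inverse.to e a , trans (sym (index-vertex x))
        (cong index (trans vx≡fa (cong f (sym (Inverse.strictlyInverseʳ e a)))))

  -- Pigeonhole form of limitedness: if all `k + 1` given neighbours avoided `D`, then `N u ─ D`
  -- would have more than `k` elements.
  limited⇒neighbour∈D : ∀ {k D u} → IsLimitedDominating G k D → u ∈ᵛ D →
    (f : Fin (suc k) → V) → Injective _≡_ _≡_ f → (∀ i → u ~ f i) → ∃[ i ] f i ∈ᵛ D
  limited⇒neighbour∈D {k} {D} {u} (_ , limited) u∈D f inj u~f
    with Fin.any? (λ i → index (f i) ∈? D)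
  ... | yes found = found
  ... | no  none  = contradiction
    (≤-trans
      (injective⇒≤∣D∣ ↔-refl (N u ─ D) f inj
        (λ i → x∈p∧x∉q⇒x∈p─q (∈-setOf⁺ (u ~?_) (u~f i)) (λ fi∈D → none (i , fi∈D))))
      (limited u u∈D))
    1+n≰n

enumerate× : ∀ {A B : Set} {m n} → A ↔ Fin m → B ↔ Fin n → (A × B) ↔ Fin (m * n)
enumerate× e e′ = ↔-trans (e ×-↔ e′) (↔-sym Fin.*↔×)

-- Combinatorics of a single block.

Selection : ∀ {n} → (Fin n → Fin n → Set) → Set
Selection {n} S =
  ∃[ f ] Injective _≡_ _≡_ f × (∀ (i : Fin n) → S (proj₁ (f i)) (proj₂ (f i)))

-- S is the trace of D on one block, with k = m + 1.  A vertex (i, j) off the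
-- centre row and column has degree 2, so it is constrained only when k = 1.
module _ {m : ℕ} (S : Fin (suc (suc m)) → Fin (suc (suc m)) → Set)
  (S?      : ∀ a b → Dec (S a b))
  (dom     : ∀ i j → S (suc i) (suc j) ⊎ S (suc i) zero ⊎ S zero (suc j))
  (limRow  : ∀ i → S (suc i) zero → S zero zero ⊎ ∃[ j ] S (suc i) (suc j))
  (limCol  : ∀ j → S zero (suc j) → S zero zero ⊎ ∃[ i ] S (suc i) (suc j))
  (limLeaf : m ≡ 0 → ∀ i j → S (suc i) (suc j) → S (suc i) zero ⊎ S zero (suc j))
  where

  private
    Index : Set
    Index = Fin (suc (suc m))

  extend : (g : Fin (suc m) → Index × Index) → Injective _≡_ _≡_ g →
           (∀ i → S (proj₁ (g i)) (proj₂ (g i))) →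
           (∃[ a ] ∃[ b ] (S a b × (∀ i → (a , b) ≢ g i))) → Selection S
  extend g inj g∈S (a , b , ab∈S , fresh) = f , f-inj , f∈S
    where
    f : Index → Index × Index
    f zero    = a , b
    f (suc i) = g i

    f-inj : Injective _≡_ _≡_ f
    f-inj {zero}  {zero}  _ = refl
    f-inj {zero}  {suc j} e = contradiction e (fresh j)
    f-inj {suc i} {zero}  e = contradiction (sym e) (fresh i)
    f-inj {suc i} {suc j} e = cong suc (inj e)

    f∈S : ∀ i → S (proj₁ (f i)) (proj₂ (f i))
    f∈S zero    = ab∈S
    f∈S (suc i) = g∈S i

  -- The row supplies `k` cells. The last one comes from applying `limCol` to the cell (0, 1): it is
  -- either (0, 0) or a cell below the centre row, so it is new in both cases.
  centreRowFull : (∀ j → S zero (suc j)) → Selection S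
  centreRowFull full = extend (λ j → zero , suc j) (λ { refl → refl }) full extra
    where
    extra : ∃[ a ] ∃[ b ] (S a b × (∀ j → (a , b) ≢ (zero , suc j)))
    extra with limCol zero (full zero)
    ... | inj₁ s       = zero , zero , s , λ _ ()
    ... | inj₂ (i , s) = suc i , suc zero , s , λ _ ()

  -- If the row's cell in column 0 is selected, limitedness adds a leaf cell, as (0, 0) is excluded.
  -- If it is not, no leaf cell of the row can be dominated from outside, so all of them are
  -- selected.
  twoInRow : (∀ b → ¬ S zero b) → ∀ i → ∃[ b ] ∃[ b′ ] (b ≢ b′ × S (suc i) b × S (suc i) b′)
  twoInRow row₀∉S i with S? (suc i) zero
  ... | yes s with limRow i s
  ...   | inj₁ s₀       = contradiction s₀ (row₀∉S zero)
  ...   | inj₂ (j , s′) = zero , suc j , (λ ()) , s , s′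
  twoInRow row₀∉S i | no i0∉S = distinctLeaves refl
    where
    leaves : ∀ j → S (suc i) (suc j)
    leaves j with dom i j
    ... | inj₁ s        = s
    ... | inj₂ (inj₁ s) = contradiction s i0∉S
    ... | inj₂ (inj₂ s) = contradiction s (row₀∉S (suc j))

    -- Case split on `m`: for `k = 1` the row has a single leaf cell, and `limLeaf` gives a
    -- contradiction; otherwise two leaf cells exist.
    distinctLeaves : ∀ {l} → m ≡ l → ∃[ b ] ∃[ b′ ] (b ≢ b′ × S (suc i) b × S (suc i) b′)
    distinctLeaves {zero} m≡0 =
      ⊥-elim ([ i0∉S , row₀∉S _ ]′ (limLeaf m≡0 i zero (leaves zero)))
    distinctLeaves {suc _} refl =
      suc zero , suc (suc zero) , (λ ()) , leaves zero , leaves (suc zero)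

  -- With the cell (0, j) missing, column j needs a selected cell in each leaf row, either there or
  -- in column 0. This gives one cell in each of `k` rows.
  leafRowsMet : ∀ j → ¬ S zero (suc j) → Selection S
  leafRowsMet j 0j∉S = extend (λ i → suc i , proj₁ (row i)) (λ e → Fin.suc-injective (cong proj₁ e))
    (proj₂ ∘ row) extra
    where
    row : ∀ i → ∃[ b ] S (suc i) b
    row i with dom i j
    ... | inj₁ s        = suc j , s
    ... | inj₂ (inj₁ s) = zero , s
    ... | inj₂ (inj₂ s) = contradiction s 0j∉S

    fresh : ∀ {i b} → b ≢ proj₁ (row i) → ∀ i′ →
            _≢_ {A = Index × Index} (suc i , b) (suc i′ , proj₁ (row i′))
    fresh b≢ i′ refl = b≢ refl

    extra : ∃[ a ] ∃[ b ] (S a b × (∀ i → (a , b) ≢ (suc i , proj₁ (row i))))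
    extra with Fin.any? (S? zero)
    ... | yes (b , s) = zero , b , s , λ _ ()
    ... | no none with twoInRow (λ b s → none (b , s)) zero
    -- Row 1 has two selected cells, and at most one of them is the cell already chosen by
    -- `row zero`.
    ...   | b , b′ , b≢b′ , s , s′ with b Fin.≟ proj₁ (row zero)
    ...     | no b≢row  = suc zero , b , s , fresh b≢row
    ...     | yes b≡row = suc zero , b′ , s′ , fresh (λ b′≡row → b≢b′ (trans b≡row (sym b′≡row)))

  selection : Selection S
  selection with Fin.all? (S? zero ∘ suc)
  ... | yes full = centreRowFull full
  ... | no ¬full with Fin.¬∀⟶∃¬ _ _ (S? zero ∘ suc) ¬full
  ...   | j , 0j∉S = leafRowsMet j 0j∉S

-- The stars that partition a corona.

module _ (k : ℕ) (F : Graph) where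
  private module F = Graph F

  star : F.V → Fin (suc k) → CoronaVertex k F
  star u zero    = inj₁ u
  star u (suc i) = inj₂ (u , i)

  -- Tells which star a vertex belongs to; applied to both coordinates it identifies the block of a
  -- vertex of the product.
  root : CoronaVertex k F → F.V
  root (inj₁ u)       = u
  root (inj₂ (u , _)) = u

  root-star : ∀ u a → root (star u a) ≡ u
  root-star u zero    = refl
  root-star u (suc i) = refl

  star-injective : ∀ {u} → Injective _≡_ _≡_ (star u)
  star-injective {x = zero}  {zero}  _    = refl
  star-injective {x = suc i} {suc j} refl = refl

  IsCentre : CoronaVertex k F → Set
  IsCentre v = ∃[ u ] v ≡ inj₁ u

  isCentre? : Decidable IsCentre
  isCentre? (inj₁ u) = yes (u , refl)
  isCentre? (inj₂ _) = no λ ()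

module _ (m : ℕ) (F F′ : Graph) where
  private
    k = suc m
    module F = Graph F
    module F′ = Graph F′
    G = corona k F
    H = corona k F′
    module G = Graph G
    module H = Graph H
    P = G □ H
    module P = Graph P

  -- Lower bound: every block meets `D` in at least `k + 1` vertices.

  module _ {D : P.VertexSet} (D-limited : IsLimitedDominating P k D) where

    cell : F.V → F′.V → Fin (suc k) × Fin (suc k) → P.V
    cell u v (a , b) = star k F u a , star k F′ v b

    cell-injective : ∀ {u v} → Injective _≡_ _≡_ (cell u v)
    cell-injective e = cong₂ _,_ (star-injective k F (cong proj₁ e)) (star-injective k F′ (cong proj₂ e))

    adjacentInRow : ∀ {u v a b b′} → H._~_ (star k F′ v b) (star k F′ v b′) →
                    cell u v (a , b) P.~ cell u v (a , b′)
    adjacentInRow b~b′ = inj₁ (refl , b~b′)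

    adjacentInColumn : ∀ {u v a a′ b} → G._~_ (star k F u a) (star k F u a′) →
                       cell u v (a , b) P.~ cell u v (a′ , b)
    adjacentInColumn a~a′ = inj₂ (refl , a~a′)

    blockSelection : ∀ u v → Selection (λ a b → cell u v (a , b) P.∈ᵛ D)
    blockSelection u v = selection S (λ a b → P.index (cell u v (a , b)) ∈? D)
      dom limRow limCol limLeaf
      where
      S : Fin (suc k) → Fin (suc k) → Set
      S a b = cell u v (a , b) P.∈ᵛ D

      -- Keeps the pigeonhole inside one block: `k + 1` distinct neighbours there exceed the limit,
      -- whatever further neighbours edges of `F` and `F′` provide.
      neighbour∈D : ∀ {a b} → S a b → (f : Fin (suc k) → Fin (suc k) × Fin (suc k)) →
                    Injective _≡_ _≡_ f → (∀ i → cell u v (a , b) P.~ cell u v (f i)) →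
                    ∃[ i ] S (proj₁ (f i)) (proj₂ (f i))
      neighbour∈D s f inj = limited⇒neighbour∈D P D-limited s (cell u v ∘ f) (inj ∘ cell-injective)

      dom : ∀ i j → S (suc i) (suc j) ⊎ S (suc i) zero ⊎ S zero (suc j)
      dom i j with P.index (cell u v (suc i , suc j)) ∈? D
      ... | yes s = inj₁ s
      ... | no ∉D with proj₁ D-limited (cell u v (suc i , suc j)) ∉D
      -- A leaf is adjacent only to its own centre, so a dominating vertex stays in the block and
      -- has one coordinate moved to the centre.
      ...   | (_ , inj₁ _) , s , inj₁ (refl , refl) = inj₂ (inj₁ s)
      ...   | (inj₁ _ , _) , s , inj₂ (refl , refl) = inj₂ (inj₂ s)

      limRow : ∀ i → S (suc i) zero → S zero zero ⊎ ∃[ j ] S (suc i) (suc j)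
      limRow i s with neighbour∈D s f f-inj adj
        where
        -- The `k + 1` neighbours are the centre (0, 0) of the block and the `k` leaf cells of the
        -- same row.
        f : Fin (suc k) → Fin (suc k) × Fin (suc k)
        f zero    = zero , zero
        f (suc j) = suc i , suc j
        f-inj : Injective _≡_ _≡_ f
        f-inj {zero}  {zero}  _    = refl
        f-inj {suc _} {suc _} refl = refl
        adj : ∀ j → cell u v (suc i , zero) P.~ cell u v (f j)
        adj zero    = adjacentInColumn refl
        adj (suc _) = adjacentInRow refl
      ... | zero  , t = inj₁ t
      ... | suc j , t = inj₂ (j , t)

      limCol : ∀ j → S zero (suc j) → S zero zero ⊎ ∃[ i ] S (suc i) (suc j)
      limCol j s with neighbour∈D s f f-inj adj
        where
        f : Fin (suc k) → Fin (suc k) × Fin (suc k)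
        f zero    = zero , zero
        f (suc i) = suc i , suc j
        f-inj : Injective _≡_ _≡_ f
        f-inj {zero}  {zero}  _    = refl
        f-inj {suc _} {suc _} refl = refl
        adj : ∀ i → cell u v (zero , suc j) P.~ cell u v (f i)
        adj zero    = adjacentInRow refl
        adj (suc _) = adjacentInColumn refl
      ... | zero  , t = inj₁ t
      ... | suc i , t = inj₂ (i , t)

      limLeaf : m ≡ 0 → ∀ i j → S (suc i) (suc j) → S (suc i) zero ⊎ S zero (suc j)
      limLeaf refl i j s with neighbour∈D s f f-inj adj
        where
        -- Here `k = 1`, so the two neighbours of a leaf cell already exceed the limit.
        f : Fin 2 → Fin 2 × Fin 2
        f zero    = suc i , zero
        f (suc _) = zero , suc j
        f-inj : Injective _≡_ _≡_ f
        f-inj {zero}     {zero}     _ = refl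
        f-inj {suc zero} {suc zero} _ = refl
        adj : ∀ i′ → cell u v (suc i , suc j) P.~ cell u v (f i′)
        adj zero    = adjacentInRow refl
        adj (suc _) = adjacentInColumn refl
      ... | zero  , t = inj₁ t
      ... | suc _ , t = inj₂ t

    -- Selections are injections, and `block` recovers the block of a picked vertex. Hence the
    -- selections of all blocks combine into one injection into `D`.
    lowerBound : F.order * F′.order * suc k ≤ ∣ D ∣
    lowerBound = injective⇒≤∣D∣ P
      (enumerate× (enumerate× F.enumerate F′.enumerate) ↔-refl) D pick pick-injective
      (λ ((u , v) , i) → proj₂ (proj₂ (blockSelection u v)) i)
      where
      pick : (F.V × F′.V) × Fin (suc k) → P.V
      pick ((u , v) , i) = cell u v (proj₁ (blockSelection u v) i)

      block : P.V → F.V × F′.V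
      block (g , h) = root k F g , root k F′ h

      block-pick : ∀ x → block (pick x) ≡ proj₁ x
      block-pick ((u , v) , i) = cong₂ _,_ (root-star k F u (proj₁ ab)) (root-star k F′ v (proj₂ ab))
        where
        ab : Fin (suc k) × Fin (suc k)
        ab = proj₁ (blockSelection u v) i

      pick-injective : Injective _≡_ _≡_ pick
      pick-injective {x@((u , v) , _)} {y} e
        with trans (sym (block-pick x)) (trans (cong block e) (block-pick y))
      ... | refl = cong ((u , v) ,_) (proj₁ (proj₂ (blockSelection u v)) (cell-injective e))

  -- Upper bound: the set V(G) × V(F′).

  centreColumn? : Decidable (λ (p : P.V) → IsCentre k F′ (proj₂ p))
  centreColumn? = isCentre? k F′ ∘ proj₂

  centreColumn : P.VertexSet
  centreColumn = setOf P centreColumn?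

  centreColumn-limited : IsLimitedDominating P k centreColumn
  centreColumn-limited = dominating , limited
    where
    ∈⁺ : ∀ p → IsCentre k F′ (proj₂ p) → p P.∈ᵛ centreColumn
    ∈⁺ p = ∈-setOf⁺ P centreColumn? {p}

    dominating : IsDominating P centreColumn
    dominating (g , inj₁ v)       ∉D = contradiction (∈⁺ (g , inj₁ v) (v , refl)) ∉D
    dominating (g , inj₂ (v , _)) ∉D = (g , inj₁ v) , ∈⁺ (g , inj₁ v) (v , refl) , inj₁ (refl , refl)

    limited : ∀ p → p P.∈ᵛ centreColumn → ∣ P.N p ─ centreColumn ∣ ≤ k
    limited p@(g , h) p∈D with ∈-setOf⁻ P centreColumn? {g , h} p∈D
    -- Moving along an edge of `G` or of `F′` stays in the set, so only the `k` leaves at `v`, with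
    -- first coordinate `g`, can lie outside it.
    ... | v , refl = covered⇒∣D∣≤ P ↔-refl (P.N p ─ centreColumn) (λ i → g , inj₂ (v , i))
      (λ {q} q∈ → cover (∈-setOf⁻ P (p P.~?_) {q} (p─q⊆p (P.N p) centreColumn q∈))
                    (x∈p─q⇒x∉q (P.N p) centreColumn q∈ ∘ ∈⁺ q))
      where
      cover : ∀ {q} → (g , inj₁ v) P.~ q → ¬ IsCentre k F′ (proj₂ q) →
              ∃[ i ] q ≡ (g , inj₂ (v , i))
      cover {_ , inj₁ w}       _                    ¬centre = contradiction (w , refl) ¬centre
      cover {_ , inj₂ (_ , i)} (inj₁ (refl , refl)) _       = i , refl

  ∣centreColumn∣≤ : ∣ centreColumn ∣ ≤ G.order * F′.order
  ∣centreColumn∣≤ = covered⇒∣D∣≤ P (enumerate× G.enumerate F′.enumerate) centreColumn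
    (λ (g , v) → g , inj₁ v) cover
    where
    cover : ∀ {p} → p P.∈ᵛ centreColumn → ∃[ x ] p ≡ (proj₁ x , inj₁ (proj₂ x))
    cover {g , h} p∈D with ∈-setOf⁻ P centreColumn? {g , h} p∈D
    ... | v , refl = (g , v) , refl

  -- The value of `γᴸ`, first as a product and then as a quotient.

  γᴸ-corona□corona : γᴸ (suc m) (corona (suc m) F □ corona (suc m) F′) ≡
                     F.order * F′.order * suc (suc m)
  γᴸ-corona□corona with minimumLimitedDominatingSet k P
  ... | D , D-limited , D-minimum = ≤-antisym
    (≤-trans (D-minimum centreColumn centreColumn-limited)
      -- The order of `G` is `n + n * k`, which contributes the factor `k + 1`.
      (≤-trans ∣centreColumn∣≤ (≤-reflexive (rearrange F.order F′.order k))))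
    (lowerBound D-limited)
    where
    rearrange : ∀ n n′ k → (n + n * k) * n′ ≡ n * n′ * suc k
    rearrange = solve 3 (λ n n′ k →
      (n :+ n :* k) :* n′ := n :* n′ :* (con 1 :+ k)) refl
      where open +-*-Solver

-- Cross-multiplication makes the unnormalised fractions equivalent, and normalisation sends
-- equivalent fractions to equal rationals.
i/1≡j/k : ∀ {i j} k → i * suc k ≡ j → (+ i) / 1 ≡ (+ j) / suc k
i/1≡j/k {i} {j} k eq = fromℚᵘ-cong {mkℚᵘ (+ i) 0} {mkℚᵘ (+ j) k} (*≡* (begin
  + i ℤ.* + suc k  ≡⟨ ℤ.pos-* i (suc k) ⟨
  + (i * suc k)    ≡⟨ cong +_ eq ⟩
  + j              ≡⟨ ℤ.*-identityʳ (+ j) ⟨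
  + j ℤ.* + 1      ∎))
  where open ≡-Reasoning

proposition11 : (k : ℕ) → 1 ≤ k → (F F′ : Graph) →
    let G = corona k F
        H = corona k F′
    in (+ γᴸ k (G □ H)) / 1 ≡ (+ (Graph.order G * Graph.order H)) / suc k
proposition11 (suc m) _ F F′ = i/1≡j/k
  -- Leaving these two arguments to unification would make Agda evaluate γᴸ.
  {γᴸ (suc m) (corona (suc m) F □ corona (suc m) F′)}
  {Graph.order (corona (suc m) F) * Graph.order (corona (suc m) F′)}
  (suc m)
  (trans (cong (_* suc (suc m)) (γᴸ-corona□corona m F F′))
         (rearrange (Graph.order F) (Graph.order F′) (suc m)))
  where
  rearrange : ∀ n n′ k → n * n′ * suc k * suc k ≡ (n + n * k) * (n′ + n′ * k)
  rearrange = solve 3 (λ n n′ k →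
    n :* n′ :* (con 1 :+ k) :* (con 1 :+ k) := (n :+ n :* k) :* (n′ :+ n′ :* k)) refl
    where open +-*-Solver
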